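{- Work in the constructive set theory $\mathbf{CZF}$ (intuitionistic logic), with $\mathbb{A}$ an infinite set with decidable equality. Suppose that at least one of the following statements holds in general, i.e. for all nominal sets $X$ and $Y$ and all elements $x$ of $X$. Then $\mathbf{WLPO}$ holds. The statements are: (1) If $X$ and $Y$ admit support functions, then so does $Y^X$. (2) If every element of $X$ and every element of $Y$ has a least finite support, then so does every element of $Y^X$. (3) The intersection of all finite supports of $x$ is finite. (4) The intersection of all finite supports of $x$ is a support of $x$. (5) $x$ has a least finite support. (6) $x$ has a least subfinite support. (7) The intersection of any two subfinite supports of $x$ is a support of $x$. (8) For every subfinite support $S$ of $x$ there is a finite support $S'$ of $x$ with $S'\subseteq S$.
   Context: Terminology: a set has decidable equality if any two of its elements are either equal or unequal. A set is finite if it is in bijection with $n=\{0,\dots,n-1\}$ for some $n\in\mathbb{N}$; finitely enumerable if it is the image of a surjection from some $n\in\mathbb{N}$; subfinite if it is a subset of a finitely enumerable set; infinite if for every finite $Y\subseteq X$ there is $x\in X$ with $x\notin Y$. $\mathbf{WLPO}$ is the statement: for every $\alpha\colon\mathbb{N}\to 2$, either $(\forall n\in\mathbb{N})\,\alpha(n)=0$ or $\neg(\forall n\in\mathbb{N})\,\alpha(n)=0$. $\operatorname{Perm}(\mathbb{A})$ is the group of finite permutations of $\mathbb{A}$ (fixing all but finitely many elements). A $\operatorname{Perm}(\mathbb{A})$-set is a set with an action $\cdot$ of this group. For $x$ in a $\operatorname{Perm}(\mathbb{A})$-set, $A\subseteq\mathbb{A}$ is a support of $x$ if every $\pi\in\operatorname{Perm}(\mathbb{A})$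 fixing each element of $A$ satisfies $\pi\cdot x=x$. A least finite (resp. subfinite) support of $x$ is a finite (resp. subfinite) support of $x$ contained in every finite (resp. subfinite) support of $x$. A nominal set is a $\operatorname{Perm}(\mathbb{A})$-set in which every element has a finite support. A support function on a nominal set $X$ is a function $S\colon X\to\mathcal{P}_{\mathrm{fin}}(\mathbb{A})$ with $S(x)$ a finite support of $x$ for each $x\in X$. For nominal sets $X,Y$, the exponential $Y^X$ is the set of functions $f\colon X\to Y$ that have a finite support with respect to the conjugation action $(\pi\cdot f)(x)=\pi\cdot f(\pi^{ -1}\cdot x)$, with that action. -}

module Defs where

open import Level using (Level; _⊔_) renaming (suc to lsuc)
open import Algebra.Bundles using (Group)
open import Data.Fin.Base using (Fin; zero; suc)
open import Data.List.Base using (List; []; _++_; length; lookup; filter; deduplicate; tabulate)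
import Data.List.Membership.Setoid as Membership
import Data.List.Membership.Setoid.Properties as MembershipP
import Data.List.Relation.Unary.All as All
import Data.List.Relation.Unary.Any as Any
import Data.List.Relation.Unary.Any.Properties as AnyP
open import Data.List.Relation.Unary.AllPairs using (_∷_)
open import Data.List.Relation.Unary.Unique.Setoid using (Unique)
import Data.List.Relation.Unary.Unique.DecSetoid.Properties as UniqueP
open import Data.Nat.Base using (ℕ)
open import Data.Product using (Σ-syntax; ∃; _×_; _,_; proj₁; proj₂)
open import Data.Sum.Base using (_⊎_)
open import Function.Base using (_∘_)
open import Function.Bundles using (Func; Injection; Surjection; Bijection; Inverse)
import Function.Construct.Composition as Compose
import Function.Construct.Identity as Identity
import Function.Construct.Symmetry as Symmetry
import Function.Relation.Binary.Setoid.Equality as FuncEquality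
open import Relation.Binary.Bundles using (Setoid; DecSetoid)
open import Relation.Binary.Definitions using (_Respects_)
import Relation.Binary.Construct.On as On
open import Relation.Binary.PropositionalEquality as ≡ using (_≡_)
import Relation.Binary.Reasoning.Setoid as SetoidReasoning
open import Relation.Nullary using (¬_; yes; no; ¬?; contradiction)
open import Relation.Unary using (Pred; Decidable)

private
  variable
    c e p q : Level

-- Sets are setoids, functions between them are equality-preserving maps,
-- and a subset is a predicate that respects the equality of the ambient set.

record Subset (S : Setoid c e) (p : Level) : Set (c ⊔ e ⊔ lsuc p) where
  open Setoid S
  field
    member   : Pred Carrier p
    respects : member Respects _≈_

module _ {S : Setoid c e} where

  open Setoid S
  open Subset

  infix 4 _∈_ _∉_ _⊆_ _≐_
  infixr 7 _∩_

  _∈_ : Carrier → Subset S p → Set p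
  x ∈ U = member U x

  _∉_ : Carrier → Subset S p → Set p
  x ∉ U = ¬ (x ∈ U)

  _⊆_ : Subset S p → Subset S q → Set (c ⊔ p ⊔ q)
  U ⊆ V = ∀ x → x ∈ U → x ∈ V

  _≐_ : Subset S p → Subset S q → Set (c ⊔ p ⊔ q)
  U ≐ V = U ⊆ V × V ⊆ U

  _∩_ : Subset S p → Subset S q → Subset S (p ⊔ q)
  U ∩ V = record
    { member   = λ x → x ∈ U × x ∈ V
    ; respects = λ x≈y (x∈U , x∈V) → respects U x≈y x∈U , respects V x≈y x∈V
    }

  subsetoid : Subset S p → Setoid (c ⊔ p) e
  subsetoid U = On.setoid {B = ∃ (member U)} S proj₁

Finite : Setoid c e → Set (c ⊔ e)
Finite S = Σ[ n ∈ ℕ ] Bijection (≡.setoid (Fin n)) S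

FinitelyEnumerable : Setoid c e → Set (c ⊔ e)
FinitelyEnumerable S = Σ[ n ∈ ℕ ] Surjection (≡.setoid (Fin n)) S

-- The finitely enumerable set need not be given as a subset of any
-- previously fixed ambient set, so "is a subset of" is "embeds into".
Subfinite : Setoid c e → Set (lsuc (c ⊔ e))
Subfinite {c} {e} S = Σ[ E ∈ Setoid c e ] FinitelyEnumerable E × Injection S E

-- Every finite subset is the image of some Fin n, hence is extensionally
-- equal to one at level e.
Infinite : Setoid c e → Set (c ⊔ lsuc e)
Infinite {c} {e} S =
  ∀ (Y : Subset S e) → Finite (subsetoid Y) → Σ[ x ∈ Setoid.Carrier S ] x ∉ Y

WLPO : Set
WLPO = (α : ℕ → Fin 2) → (∀ n → α n ≡ zero) ⊎ ¬ (∀ n → α n ≡ zero)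

module _ {S : Setoid c e} where
  open Setoid S
  open Membership S using () renaming (_∈_ to _∈ₗ_)

  finite⇒list : (U : Subset S p) → Finite (subsetoid U) →
                Σ[ xs ∈ List Carrier ] (∀ x → x ∈ U → x ∈ₗ xs)
  finite⇒list U (n , b) = tabulate (proj₁ ∘ to) , λ x x∈U →
    let (i , to-i≈x) = surjective (x , x∈U)
    in AnyP.tabulate⁺ i (sym (to-i≈x ≡.refl))
    where open Bijection b

  ≉-resp : ∀ {x} → (λ y → ¬ (x ≈ y)) Respects _≈_
  ≉-resp y≈z x≉y x≈z = x≉y (trans x≈z (sym y≈z))

  lookup-injective : ∀ {xs} → Unique S xs → ∀ i j → lookup xs i ≈ lookup xs j → i ≡ j
  lookup-injective (_  ∷ _)  zero    zero    _  = ≡.refl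
  lookup-injective (x# ∷ _)  zero    (suc j) eq = contradiction eq (All.lookupₛ S ≉-resp x# (MembershipP.∈-lookup S _ j))
  lookup-injective (x# ∷ _)  (suc i) zero    eq = contradiction (sym eq) (All.lookupₛ S ≉-resp x# (MembershipP.∈-lookup S _ i))
  lookup-injective (_  ∷ u)  (suc i) (suc j) eq = ≡.cong suc (lookup-injective u i j eq)

list⇒finite : (D : DecSetoid c e) (U : Subset (DecSetoid.setoid D) p) →
              Decidable (Subset.member U) → (xs : List (DecSetoid.Carrier D)) →
              (∀ x → x ∈ U → Membership._∈_ (DecSetoid.setoid D) x xs) → Finite (subsetoid U)
list⇒finite D U U? xs U⊆xs = length ys , record
  { to        = λ i → lookup ys i , ys⊆U i
  ; cong      = λ { ≡.refl → refl }
  ; bijective = (λ {i} {j} → lookup-injective {S = setoid} {xs = ys} ys-unique i j)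
              , λ (x , x∈U) → let x∈ys = U⊆ys x x∈U in
                  Any.index x∈ys , λ { ≡.refl → sym (AnyP.lookup-index x∈ys) }
  }
  where
  open DecSetoid D
  open Membership setoid using () renaming (_∈_ to _∈ₗ_)
  open Subset U
  ys = deduplicate _≟_ (filter U? xs)
  ys-unique = UniqueP.deduplicate-! D (filter U? xs)
  ys⊆U : ∀ i → lookup ys i ∈ U
  ys⊆U i = proj₂ (MembershipP.∈-filter⁻ setoid U? respects {xs = xs}
    (MembershipP.∈-deduplicate⁻ setoid _≟_ (filter U? xs) (MembershipP.∈-lookup setoid ys i)))
  U⊆ys : ∀ x → x ∈ U → x ∈ₗ ys
  U⊆ys x x∈U = MembershipP.∈-deduplicate⁺ setoid _≟_ (λ z≈y w≈y → trans w≈y (sym z≈y))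
    (MembershipP.∈-filter⁺ setoid U? respects (U⊆xs x x∈U) x∈U)

record GSet (G : Group c e) (x r : Level) : Set (c ⊔ e ⊔ lsuc (x ⊔ r)) where
  private module G = Group G
  infixr 6 _·_
  field
    setoid : Setoid x r
  open Setoid setoid public
  field
    _·_    : G.Carrier → Carrier → Carrier
    ·-cong : ∀ {g h x y} → g G.≈ h → x ≈ y → g · x ≈ h · y
    ε·     : ∀ x → G.ε · x ≈ x
    ∙·     : ∀ g h x → (g G.∙ h) · x ≈ g · (h · x)

  ·-congˡ : ∀ g {x y} → x ≈ y → g · x ≈ g · y
  ·-congˡ g = ·-cong G.refl

  ⁻¹·· : ∀ g x → g G.⁻¹ · (g · x) ≈ x
  ⁻¹·· g x = trans (sym (∙· _ _ x)) (trans (·-cong (G.inverseˡ g) refl) (ε· x))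

  ·⁻¹· : ∀ g x → g · (g G.⁻¹ · x) ≈ x
  ·⁻¹· g x = trans (sym (∙· _ _ x)) (trans (·-cong (G.inverseʳ g) refl) (ε· x))

module _ {G : Group c e} where
  private module G = Group G
  open import Algebra.Properties.Group G using (ε⁻¹≈ε; ⁻¹-anti-homo-∙)

  functionGSet : ∀ {x r y s} → GSet G x r → GSet G y s → GSet G (x ⊔ r ⊔ y ⊔ s) (x ⊔ s)
  functionGSet X Y = record
    { setoid = FuncEquality.setoid X.setoid Y.setoid
    ; _·_    = λ g f → record
      { to   = λ x → g Y.· to f (g G.⁻¹ X.· x)
      ; cong = λ x≈y → Y.·-congˡ g (cong f (X.·-congˡ (g G.⁻¹) x≈y))
      }
    ; ·-cong = λ {_} {_} {f} {f′} g≈h f≈f′ x → Y.·-cong g≈h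
        (Y.trans (f≈f′ _) (cong f′ (X.·-cong (G.⁻¹-cong g≈h) X.refl)))
    ; ε·     = λ f x → Y.trans (Y.ε· _)
        (cong f (X.trans (X.·-cong ε⁻¹≈ε X.refl) (X.ε· x)))
    ; ∙·     = λ g h f x → Y.trans (Y.∙· g h _)
        (Y.·-congˡ g (Y.·-congˡ h (cong f
          (X.trans (X.·-cong (⁻¹-anti-homo-∙ g h) X.refl) (X.∙· _ _ x)))))
    }
    where
    module X = GSet X
    module Y = GSet Y
    open Func

module Nominal {ℓ : Level} (𝔸 : DecSetoid ℓ ℓ) where

  private module 𝔸 = DecSetoid 𝔸

  Atoms : Setoid ℓ ℓ
  Atoms = 𝔸.setoid

  nonFixed : Inverse Atoms Atoms → Subset Atoms ℓ
  nonFixed π = record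
    { member   = λ a → ¬ (to a 𝔸.≈ a)
    ; respects = λ a≈b πa≉a πb≈b →
        πa≉a (𝔸.trans (to-cong a≈b) (𝔸.trans πb≈b (𝔸.sym a≈b)))
    }
    where open Inverse π

  record FinitePermutation : Set ℓ where
    field
      inverse        : Inverse Atoms Atoms
      nonFixedFinite : Finite (subsetoid (nonFixed inverse))
    open Inverse inverse public hiding (inverse)

  open FinitePermutation

  nonFixed⊆list⇒finite : ∀ π xs → (∀ a → a ∈ nonFixed π → Membership._∈_ Atoms a xs) →
                         Finite (subsetoid (nonFixed π))
  nonFixed⊆list⇒finite π = list⇒finite 𝔸 (nonFixed π) (λ a → ¬? (Inverse.to π a 𝔸.≟ a))

  idᵖ : FinitePermutation
  idᵖ = record
    { inverse        = Identity.inverse Atoms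
    ; nonFixedFinite = nonFixed⊆list⇒finite (Identity.inverse Atoms) [] λ a a≉a → contradiction 𝔸.refl a≉a
    }

  _⁻¹ᵖ : FinitePermutation → FinitePermutation
  π ⁻¹ᵖ = record
    { inverse        = Symmetry.inverse (inverse π)
    ; nonFixedFinite =
        let (xs , ⊆xs) = finite⇒list (nonFixed (inverse π)) (nonFixedFinite π)
        in nonFixed⊆list⇒finite (Symmetry.inverse (inverse π)) xs λ a π⁻¹a≉a → ⊆xs a λ πa≈a →
             π⁻¹a≉a (inverseʳ π (𝔸.sym πa≈a))
    }

  _∘ᵖ_ : FinitePermutation → FinitePermutation → FinitePermutation
  π ∘ᵖ ρ = record
    { inverse        = Compose.inverse (inverse ρ) (inverse π)
    ; nonFixedFinite =
        let (xs , ⊆xs) = finite⇒list (nonFixed (inverse π)) (nonFixedFinite π)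
            (ys , ⊆ys) = finite⇒list (nonFixed (inverse ρ)) (nonFixedFinite ρ)
        in nonFixed⊆list⇒finite (Compose.inverse (inverse ρ) (inverse π)) (xs ++ ys)
             (nonFixed-∘⊆ xs ys ⊆xs ⊆ys)
    }
    where
    nonFixed-∘⊆ : ∀ xs ys →
      (∀ a → a ∈ nonFixed (inverse π) → Membership._∈_ Atoms a xs) →
      (∀ a → a ∈ nonFixed (inverse ρ) → Membership._∈_ Atoms a ys) →
      ∀ a → ¬ (to π (to ρ a) 𝔸.≈ a) → Membership._∈_ Atoms a (xs ++ ys)
    nonFixed-∘⊆ xs ys ⊆xs ⊆ys a πρa≉a with to ρ a 𝔸.≟ a
    ... | no  ρa≉a = MembershipP.∈-++⁺ʳ Atoms xs (⊆ys a ρa≉a)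
    ... | yes ρa≈a = MembershipP.∈-++⁺ˡ Atoms
            (⊆xs a λ πa≈a → πρa≉a (𝔸.trans (to-cong π ρa≈a) πa≈a))

  Perm : Group ℓ ℓ
  Perm = record
    { Carrier = FinitePermutation
    ; _≈_     = λ π ρ → ∀ a → to π a 𝔸.≈ to ρ a
    ; _∙_     = _∘ᵖ_
    ; ε       = idᵖ
    ; _⁻¹     = _⁻¹ᵖ
    ; isGroup = record
      { isMonoid = record
        { isSemigroup = record
          { isMagma = record
            { isEquivalence = record
              { refl  = λ _ → 𝔸.refl
              ; sym   = λ π≈ρ a → 𝔸.sym (π≈ρ a)
              ; trans = λ π≈ρ ρ≈σ a → 𝔸.trans (π≈ρ a) (ρ≈σ a)
              }
            ; ∙-cong = λ {π} {π′} {ρ} {ρ′} π≈π′ ρ≈ρ′ a → 𝔸.trans (to-cong π (ρ≈ρ′ a)) (π≈π′ _)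
            }
          ; assoc = λ _ _ _ _ → 𝔸.refl
          }
        ; identity = (λ _ _ → 𝔸.refl) , (λ _ _ → 𝔸.refl)
        }
      ; inverse = (λ π a → strictlyInverseʳ π a) , (λ π a → strictlyInverseˡ π a)
      ; ⁻¹-cong = λ {π} {ρ} π≈ρ a → inverseʳ π
          (𝔸.trans (𝔸.sym (strictlyInverseˡ ρ a)) (𝔸.sym (π≈ρ _)))
      }
    }

  private module Perm = Group Perm

  PermSet : (x r : Level) → Set (ℓ ⊔ lsuc (x ⊔ r))
  PermSet = GSet Perm

  -- The set of finite subsets of 𝔸, with extensional equality.
  𝒫fin : Setoid (lsuc ℓ) ℓ
  𝒫fin = record
    { Carrier       = Σ[ U ∈ Subset Atoms ℓ ] Finite (subsetoid U)
    ; _≈_           = λ (U , _) (V , _) → U ≐ V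
    ; isEquivalence = record
      { refl  = (λ _ a∈U → a∈U) , (λ _ a∈U → a∈U)
      ; sym   = λ (U⊆V , V⊆U) → V⊆U , U⊆V
      ; trans = λ (U⊆V , V⊆U) (V⊆W , W⊆V) →
          (λ a a∈U → V⊆W a (U⊆V a a∈U)) , (λ a a∈W → V⊆U a (W⊆V a a∈W))
      }
    }

  module _ {x r : Level} (X : PermSet x r) where
    open GSet X

    IsSupport : Subset Atoms p → Carrier → Set (ℓ ⊔ p ⊔ r)
    IsSupport A x = ∀ (π : FinitePermutation) → (∀ a → a ∈ A → to π a 𝔸.≈ a) → π · x ≈ x

    IsFiniteSupport : Subset Atoms p → Carrier → Set (ℓ ⊔ p ⊔ r)
    IsFiniteSupport A x = Finite (subsetoid A) × IsSupport A x

    IsSubfiniteSupport : Subset Atoms ℓ → Carrier → Set (lsuc ℓ ⊔ r)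
    IsSubfiniteSupport A x = Subfinite (subsetoid A) × IsSupport A x

    HasFiniteSupport : Carrier → Set (lsuc ℓ ⊔ r)
    HasFiniteSupport x = Σ[ A ∈ Subset Atoms ℓ ] IsFiniteSupport A x

    HasLeastFiniteSupport : Carrier → Set (lsuc ℓ ⊔ r)
    HasLeastFiniteSupport x = Σ[ A ∈ Subset Atoms ℓ ]
      IsFiniteSupport A x × (∀ (B : Subset Atoms ℓ) → IsFiniteSupport B x → A ⊆ B)

    HasLeastSubfiniteSupport : Carrier → Set (lsuc ℓ ⊔ r)
    HasLeastSubfiniteSupport x = Σ[ A ∈ Subset Atoms ℓ ]
      IsSubfiniteSupport A x × (∀ (B : Subset Atoms ℓ) → IsSubfiniteSupport B x → A ⊆ B)

    ⋂FiniteSupports : Carrier → Subset Atoms (lsuc ℓ ⊔ r)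
    ⋂FiniteSupports x = record
      { member   = λ a → ∀ (A : Subset Atoms ℓ) → IsFiniteSupport A x → a ∈ A
      ; respects = λ a≈b a∈⋂ A A-supp → Subset.respects A a≈b (a∈⋂ A A-supp)
      }

    ·-hasFiniteSupport : ∀ π {x} → HasFiniteSupport x → HasFiniteSupport (π · x)
    ·-hasFiniteSupport π {x} (A , (n , b) , A-supp) = πA , (n , πA-bij) , πA-supp
      where
      module b = Bijection b
      π⁻¹ = π Perm.⁻¹
      πA : Subset Atoms ℓ
      πA = record
        { member   = λ a → from π a ∈ A
        ; respects = λ a≈b → Subset.respects A (from-cong π a≈b)
        }
      πA-bij : Bijection (≡.setoid (Fin n)) (subsetoid πA)
      πA-bij = record
        { to        = λ i → to π (proj₁ (b.to i))
                          , Subset.respects A (𝔸.sym (strictlyInverseʳ π _)) (proj₂ (b.to i))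
        ; cong      = λ { ≡.refl → 𝔸.refl }
        ; bijective =
            (λ eq → b.injective (𝔸.trans (𝔸.sym (strictlyInverseʳ π _)) (inverseʳ π eq)))
          , λ (a , a∈πA) → let (i , h) = b.surjective (from π a , a∈πA) in
              i , λ j≡i → inverseˡ π (h j≡i)
        }
      πA-supp : IsSupport πA (π · x)
      πA-supp ρ ρ-fixes = begin
        ρ · π · x                            ≈⟨ ·⁻¹· π _ ⟨
        π · π⁻¹ · ρ · π · x                  ≈⟨ ·-congˡ π (·-congˡ π⁻¹ (∙· ρ π x)) ⟨
        π · π⁻¹ · (ρ Perm.∙ π) · x           ≈⟨ ·-congˡ π (∙· π⁻¹ _ x) ⟨
        π · (π⁻¹ Perm.∙ (ρ Perm.∙ π)) · x    ≈⟨ ·-congˡ π (A-supp _ conj-fixes) ⟩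
        π · x                                ∎
        where
        open SetoidReasoning setoid
        conj-fixes : ∀ a → a ∈ A → from π (to ρ (to π a)) 𝔸.≈ a
        conj-fixes a a∈A = inverseʳ π
          (ρ-fixes (to π a) (Subset.respects A (𝔸.sym (strictlyInverseʳ π a)) a∈A))

  record NominalSet (x r : Level) : Set (lsuc (ℓ ⊔ x ⊔ r)) where
    field
      permSet          : PermSet x r
      hasFiniteSupport : ∀ x → HasFiniteSupport permSet x
    open GSet permSet public

  open NominalSet

  AdmitsSupportFunction : ∀ {x r} → NominalSet x r → Set (lsuc ℓ ⊔ x ⊔ r)
  AdmitsSupportFunction X = Σ[ S ∈ Func (setoid X) 𝒫fin ]
    (∀ x → IsSupport (permSet X) (proj₁ (Func.to S x)) x)

  finitelySupportedPart : ∀ {x r} → PermSet x r → NominalSet (lsuc ℓ ⊔ x ⊔ r) r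
  finitelySupportedPart X = record
    { permSet = record
      { setoid = On.setoid {B = ∃ (HasFiniteSupport X)} X.setoid proj₁
      ; _·_    = λ π (x , s) → π X.· x , ·-hasFiniteSupport X π s
      ; ·-cong = X.·-cong
      ; ε·     = λ (x , _) → X.ε· x
      ; ∙·     = λ π ρ (x , _) → X.∙· π ρ x
      }
    ; hasFiniteSupport = proj₂
    }
    where module X = GSet X

  infixr 8 _^_
  _^_ : ∀ {x r y s} → NominalSet y s → NominalSet x r → NominalSet (lsuc ℓ ⊔ x ⊔ r ⊔ y ⊔ s) (x ⊔ s)
  Y ^ X = finitelySupportedPart (functionGSet (permSet X) (permSet Y))

{-# OPTIONS --safe #-}

-- Statements (3)–(8) are applied to the nominal set 𝔸/P, the atoms with a and b
-- identified if a = b or P holds.  There a set A of atoms is a support of a as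
-- soon as a ∉ A implies P, while a support missing both a and some b ≠ a forces
-- P.  So the supports of a encode P, and for suitable P (with Q = "α vanishes",
-- which is ¬¬-stable, either ¬ Q or Q ∨ ¬ Q) each statement decides Q.
--
-- Statements (1) and (2) both give a support function S on 𝔸^ℕ.  Pick b outside
-- S(const a) and let f(n) be a or b according to α(n).  If b ∉ S(f),
-- then f never takes the value b, so α vanishes; if b ∈ S(f), then
-- S(f) ≠ S(const a), so α does not vanish.
module Submission where

open import Defs
open import Level using (Level; Lift; lift; lower)
open import Data.Empty using (⊥)
open import Data.Fin.Base using (Fin; zero; suc)
import Data.Fin.Properties as Fin
open import Data.List.Base using (List; []; _∷_)
import Data.List.Membership.DecSetoid as DecMembership
import Data.List.Membership.Setoid.Properties as MembershipP
open import Data.List.Relation.Unary.Any using (here; there)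
open import Data.Nat.Base using (ℕ)
open import Data.Product using (Σ-syntax; _×_; _,_; proj₁; proj₂)
open import Data.Sum using (_⊎_; inj₁; inj₂; [_,_]′)
open import Function.Base using (_∘_; case_of_; const; id)
open import Function.Bundles using (Func; Bijection; Inverse)
open import Relation.Binary.Bundles using (Setoid; DecSetoid)
open import Relation.Binary.PropositionalEquality as ≡ using (_≡_)
open import Relation.Nullary using (¬_; Dec; yes; no; contradiction; decidable-stable)
open import Relation.Nullary.Decidable using (map′)
open import Relation.Unary using (Decidable)

private
  variable
    c e p q x r : Level

-- Decidable membership and double negation

finite⇒finitelyEnumerable : {S : Setoid c e} → Finite S → FinitelyEnumerable S
finite⇒finitelyEnumerable (n , b) = n , Bijection.surjection b

-- Search through the `n` enumerated elements, comparing each with `x`. This is how a finite support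
-- comes to decide a proposition.
finite⇒decidable : (D : DecSetoid c e) (U : Subset (DecSetoid.setoid D) p) →
                   Finite (subsetoid U) → Decidable (Subset.member U)
finite⇒decidable D U (n , b) x = map′
  (λ (i , to-i≈x) → Subset.respects U to-i≈x (proj₂ (to i)))
  (λ x∈U → let (i , h) = surjective (x , x∈U) in i , h ≡.refl)
  (Fin.any? λ i → proj₁ (to i) ≟ x)
  where
  open DecSetoid D using (_≟_)
  open Bijection b

Vanishes : (ℕ → Fin 2) → Set
Vanishes α = ∀ n → α n ≡ zero

-- Each equation `α n ≡ zero` is decidable, hence stable, and stability passes through the universal
-- quantifier.
vanishes-stable : ∀ α → ¬ ¬ Vanishes α → Vanishes α
vanishes-stable α ¬¬v n = decidable-stable (α n Fin.≟ zero) λ αn≢0 → ¬¬v λ v → αn≢0 (v n)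

¬¬[⊎¬] : {Q : Set q} → ¬ ¬ (Q ⊎ ¬ Q)
¬¬[⊎¬] ¬lem = ¬lem (inj₂ (¬lem ∘ inj₁))

module _ {ℓ : Level} (𝔸 : DecSetoid ℓ ℓ) where

  open Nominal 𝔸
  open NominalSet using (permSet; Carrier)
  open FinitePermutation using (to; to-cong)
  private module 𝔸 = DecSetoid 𝔸
  open 𝔸 using (_≟_)
  open DecMembership 𝔸 using () renaming (_∈_ to _∈ₗ_; _∈?_ to _∈ₗ?_)

  -- Transpositions of atoms

  swap : 𝔸.Carrier → 𝔸.Carrier → 𝔸.Carrier → 𝔸.Carrier
  swap a b x with x ≟ a
  ... | yes _ = b
  ... | no  _ with x ≟ b
  ...   | yes _ = a
  ...   | no  _ = x

  swap-fst : ∀ a b {x} → x 𝔸.≈ a → swap a b x 𝔸.≈ b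
  swap-fst a b {x} x≈a with x ≟ a
  ... | yes _   = 𝔸.refl
  ... | no  x≉a = contradiction x≈a x≉a

  swap-snd : ∀ a b {x} → x 𝔸.≈ b → swap a b x 𝔸.≈ a
  swap-snd a b {x} x≈b with x ≟ a
  ... | yes x≈a = 𝔸.trans (𝔸.sym x≈b) x≈a
  ... | no  _ with x ≟ b
  ...   | yes _   = 𝔸.refl
  ...   | no  x≉b = contradiction x≈b x≉b

  swap-other : ∀ a b {x} → ¬ x 𝔸.≈ a → ¬ x 𝔸.≈ b → swap a b x 𝔸.≈ x
  swap-other a b {x} x≉a x≉b with x ≟ a
  ... | yes x≈a = contradiction x≈a x≉a
  ... | no  _ with x ≟ b
  ...   | yes x≈b = contradiction x≈b x≉b
  ...   | no  _   = 𝔸.refl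

  swap-cong : ∀ a b {x y} → x 𝔸.≈ y → swap a b x 𝔸.≈ swap a b y
  swap-cong a b {x} {y} x≈y with x ≟ a
  ... | yes x≈a = 𝔸.sym (swap-fst a b (𝔸.trans (𝔸.sym x≈y) x≈a))
  ... | no  x≉a with x ≟ b
  ...   | yes x≈b = 𝔸.sym (swap-snd a b (𝔸.trans (𝔸.sym x≈y) x≈b))
  ...   | no  x≉b = 𝔸.trans x≈y
            (𝔸.sym (swap-other a b (x≉a ∘ 𝔸.trans x≈y) (x≉b ∘ 𝔸.trans x≈y)))

  swap-involutive : ∀ a b x → swap a b (swap a b x) 𝔸.≈ x
  swap-involutive a b x with x ≟ a
  ... | yes x≈a = 𝔸.trans (swap-snd a b 𝔸.refl) (𝔸.sym x≈a)
  ... | no  x≉a with x ≟ b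
  ...   | yes x≈b = 𝔸.trans (swap-fst a b 𝔸.refl) (𝔸.sym x≈b)
  ...   | no  x≉b = swap-other a b x≉a x≉b

  swapᵖ : 𝔸.Carrier → 𝔸.Carrier → FinitePermutation
  swapᵖ a b = record
    { inverse        = swapⁱ
    ; nonFixedFinite = nonFixed⊆list⇒finite swapⁱ (a ∷ b ∷ []) moved⊆
    }
    where
    swap-inverse : ∀ {x y} → y 𝔸.≈ swap a b x → swap a b y 𝔸.≈ x
    swap-inverse y≈ = 𝔸.trans (swap-cong a b y≈) (swap-involutive a b _)
    swapⁱ : Inverse Atoms Atoms
    swapⁱ = record
      { to        = swap a b
      ; from      = swap a b
      ; to-cong   = swap-cong a b
      ; from-cong = swap-cong a b
      ; inverse   = swap-inverse , swap-inverse
      }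
    moved⊆ : ∀ x → ¬ swap a b x 𝔸.≈ x → x ∈ₗ (a ∷ b ∷ [])
    moved⊆ x moved with x ≟ a
    ... | yes x≈a = here x≈a
    ... | no  _ with x ≟ b
    ...   | yes x≈b = there (here x≈b)
    ...   | no  _   = contradiction 𝔸.refl moved

  swap-fixes : (X : PermSet x r) (A : Subset Atoms p) {y : GSet.Carrier X} → IsSupport X A y →
               ∀ {a b} → a ∉ A → b ∉ A → GSet._≈_ X (GSet._·_ X (swapᵖ a b) y) y
  swap-fixes X A A-supp {a} {b} a∉A b∉A = A-supp (swapᵖ a b) λ d d∈A →
    swap-other a b (λ d≈a → a∉A (respects d≈a d∈A)) (λ d≈b → b∉A (respects d≈b d∈A))
    where open Subset A

  finite? : (U : Subset Atoms p) → Finite (subsetoid U) → ∀ a → Dec (a ∈ U)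
  finite? = finite⇒decidable 𝔸

  -- Finite and subfinite sets of atoms

  fromList : List 𝔸.Carrier → Subset Atoms ℓ
  fromList xs = record { member = _∈ₗ xs ; respects = MembershipP.∈-resp-≈ Atoms }

  fromList-finite : ∀ xs → Finite (subsetoid (fromList xs))
  fromList-finite xs = list⇒finite 𝔸 (fromList xs) (_∈ₗ? xs) xs λ _ → id

  ∅ : Subset Atoms ℓ
  ∅ = record { member = λ _ → Lift ℓ ⊥ ; respects = λ _ → id }

  ∅-finite : Finite (subsetoid ∅)
  ∅-finite = list⇒finite 𝔸 ∅ (λ _ → no lower) [] λ _ ()

  ｛_｝ : 𝔸.Carrier → Subset Atoms ℓ
  ｛ a ｝ = record { member = 𝔸._≈ a ; respects = λ x≈y x≈a → 𝔸.trans (𝔸.sym x≈y) x≈a }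

  ｛｝-finite : ∀ a → Finite (subsetoid ｛ a ｝)
  ｛｝-finite a = list⇒finite 𝔸 ｛ a ｝ (_≟ a) (a ∷ []) λ _ → here

  ｛_∣_｝ : 𝔸.Carrier → Set → Subset Atoms ℓ
  ｛ a ∣ Q ｝ = record
    { member   = λ x → x 𝔸.≈ a × Q
    ; respects = λ x≈y (x≈a , q) → 𝔸.trans (𝔸.sym x≈y) x≈a , q
    }

  -- The inclusion into the singleton needs no knowledge of `Q`, whereas finiteness of `｛ a ∣ Q ｝`
  -- would decide `Q`.
  ｛∣｝-subfinite : ∀ a Q → Subfinite (subsetoid ｛ a ∣ Q ｝)
  ｛∣｝-subfinite a Q = subsetoid ｛ a ｝ , finite⇒finitelyEnumerable (｛｝-finite a) , record
    { to        = λ (x , x≈a , _) → x , x≈a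
    ; cong      = id
    ; injective = id
    }

  -- The nominal set 𝔸/P and its supports

  quotientPermSet : Set → PermSet ℓ ℓ
  quotientPermSet P = record
    { setoid = record
      { Carrier       = 𝔸.Carrier
      ; _≈_           = λ a b → a 𝔸.≈ b ⊎ P
      ; isEquivalence = record
        { refl  = inj₁ 𝔸.refl
        ; sym   = [ inj₁ ∘ 𝔸.sym , inj₂ ]′
        ; trans = λ where
            (inj₁ a≈b) (inj₁ b≈c) → inj₁ (𝔸.trans a≈b b≈c)
            (inj₁ _)   (inj₂ p)   → inj₂ p
            (inj₂ p)   _          → inj₂ p
        }
      }
    ; _·_    = to
    ; ·-cong = λ {_} {h} g≈h →
        [ (λ a≈b → inj₁ (𝔸.trans (g≈h _) (to-cong h a≈b))) , inj₂ ]′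
    ; ε·     = λ _ → inj₁ 𝔸.refl
    ; ∙·     = λ _ _ _ → inj₁ 𝔸.refl
    }

  module _ {P : Set} {a : 𝔸.Carrier} where

    -- Whether `π` moves `a` is decidable. If it does, `a` cannot lie in `A`, whose elements `π`
    -- fixes, so `P` holds and identifies everything.
    isSupport : (A : Subset Atoms p) → (a ∉ A → P) → IsSupport (quotientPermSet P) A a
    isSupport A a∉A⇒P π π-fixes with to π a ≟ a
    ... | yes πa≈a = inj₁ πa≈a
    ... | no  πa≉a = inj₂ (a∉A⇒P (πa≉a ∘ π-fixes a))

    -- The transposition of `a` and `b` fixes `A` pointwise but sends `a` to `b`, so these atoms are
    -- equal in the quotient.
    isSupport⁻ : (A : Subset Atoms p) → IsSupport (quotientPermSet P) A a →
                 ∀ {b} → a ∉ A → b ∉ A → ¬ b 𝔸.≈ a → P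
    isSupport⁻ A A-supp {b} a∉A b∉A b≉a with swap-fixes (quotientPermSet P) A A-supp a∉A b∉A
    ... | inj₁ ab·a≈a = contradiction (𝔸.trans (𝔸.sym (swap-fst a b 𝔸.refl)) ab·a≈a) b≉a
    ... | inj₂ p      = p

    ｛｝-isFiniteSupport : IsFiniteSupport (quotientPermSet P) ｛ a ｝ a
    ｛｝-isFiniteSupport = ｛｝-finite a , isSupport ｛ a ｝ (contradiction 𝔸.refl)

    -- Under `P` all atoms are identified, so even `∅` is a support of `a`.
    ∈⋂⇒¬ : a ∈ ⋂FiniteSupports (quotientPermSet P) a → ¬ P
    ∈⋂⇒¬ a∈⋂ p = lower (a∈⋂ ∅ (∅-finite , isSupport ∅ (const p)))

  quotient : Set → NominalSet ℓ ℓ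
  quotient P = record
    { permSet          = quotientPermSet P
    ; hasFiniteSupport = λ a → ｛ a ｝ , ｛｝-isFiniteSupport
    }

  -- Discrete ℕ and consequences of least supports

  discreteℕ : NominalSet ℓ ℓ
  discreteℕ = record
    { permSet = record
      { setoid = ≡.setoid (Lift ℓ ℕ)
      ; _·_    = λ _ n → n
      ; ·-cong = λ _ n≡m → n≡m
      ; ε·     = λ _ → ≡.refl
      ; ∙·     = λ _ _ _ → ≡.refl
      }
    ; hasFiniteSupport = λ _ → ∅ , ∅-finite , λ _ _ → ≡.refl
    }

  discreteℕ-leastFiniteSupport : ∀ n → HasLeastFiniteSupport (permSet discreteℕ) n
  discreteℕ-leastFiniteSupport n = ∅ , (∅-finite , λ _ _ → ≡.refl) , λ _ _ _ ()

  -- A support function must respect equality. Equal elements have the same supports, so their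
  -- chosen least ones contain each other.
  leastFiniteSupports⇒supportFunction : (X : NominalSet x r) →
    (∀ y → HasLeastFiniteSupport (permSet X) y) → AdmitsSupportFunction X
  leastFiniteSupports⇒supportFunction X least =
    record
      { to   = λ y → let (A , (A-fin , _) , _) = least y in A , A-fin
      ; cong = λ y≈z → least-⊆ y≈z , least-⊆ (X.sym y≈z)
      }
    , λ y → let (_ , (_ , A-supp) , _) = least y in A-supp
    where
    module X = NominalSet X
    least-⊆ : ∀ {y z} → y X.≈ z → proj₁ (least y) ⊆ proj₁ (least z)
    least-⊆ {y} {z} y≈z =
      let (_ , _ , minimal)          = least y
          (B , (B-fin , B-supp) , _) = least z
      in minimal B (B-fin , λ π π-fixes →
           X.trans (X.·-congˡ π y≈z) (X.trans (B-supp π π-fixes) (X.sym y≈z)))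

  -- The least support lies inside the intersection, and any set containing a support is a support.
  leastFiniteSupport⇒support⋂ : (X : PermSet x r) {y : GSet.Carrier X} →
    HasLeastFiniteSupport X y → IsSupport X (⋂FiniteSupports X y) y
  leastFiniteSupport⇒support⋂ X (A , (_ , A-supp) , minimal) π π-fixes =
    A-supp π λ a a∈A → π-fixes a λ B B-supp → minimal B B-supp a a∈A

  leastSubfiniteSupport⇒support∩ : (X : PermSet x r) {y : GSet.Carrier X} →
    HasLeastSubfiniteSupport X y → (S T : Subset Atoms ℓ) →
    IsSubfiniteSupport X S y → IsSubfiniteSupport X T y → IsSupport X (S ∩ T) y
  leastSubfiniteSupport⇒support∩ X (A , (_ , A-supp) , minimal) S T S-supp T-supp π π-fixes =
    A-supp π λ a a∈A → π-fixes a (minimal S S-supp a a∈A , minimal T T-supp a a∈A)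

  -- Fresh atoms

  module _ (infinite : Infinite Atoms) where

    freshFor : (xs : List 𝔸.Carrier) → Σ[ b ∈ 𝔸.Carrier ] ¬ (b ∈ₗ xs)
    freshFor xs = infinite (fromList xs) (fromList-finite xs)

    fresh : (A : Subset Atoms p) → Finite (subsetoid A) → ∀ a →
            Σ[ b ∈ 𝔸.Carrier ] b ∉ A × ¬ b 𝔸.≈ a
    fresh A A-fin a =
      let (xs , A⊆xs) = finite⇒list A A-fin
          (b , b∉)    = freshFor (a ∷ xs)
      in b , b∉ ∘ there ∘ A⊆xs b , b∉ ∘ here

    atom : 𝔸.Carrier
    atom = proj₁ (freshFor [])

    finiteSupport∌⇒ : ∀ {P a} (A : Subset Atoms p) → IsFiniteSupport (quotientPermSet P) A a →
                      a ∉ A → P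
    finiteSupport∌⇒ {a = a} A (A-fin , A-supp) a∉A =
      let (_ , b∉A , b≉a) = fresh A A-fin a in isSupport⁻ A A-supp a∉A b∉A b≉a

    -- Intersections of supports need not be finite, so the second missed atom comes from the bound
    -- `｛ a ｝`: any atom other than `a` is outside `A`.
    support⊆｛｝∌⇒ : ∀ {P a} (A : Subset Atoms p) → IsSupport (quotientPermSet P) A a →
                    A ⊆ ｛ a ｝ → a ∉ A → P
    support⊆｛｝∌⇒ {a = a} A A-supp A⊆｛a｝ a∉A =
      let (b , _ , b≉a) = fresh ∅ ∅-finite a in isSupport⁻ A A-supp a∉A (b≉a ∘ A⊆｛a｝ b) b≉a

    -- 𝔸/⊥ is 𝔸 itself. A finite support of `a` has decidable membership, and missing `a` would
    -- prove ⊥.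
    quotient-⊥-leastFiniteSupport : ∀ a → HasLeastFiniteSupport (quotientPermSet ⊥) a
    quotient-⊥-leastFiniteSupport a = ｛ a ｝ , ｛｝-isFiniteSupport , λ B B-supp x x≈a →
      Subset.respects B (𝔸.sym x≈a)
        (decidable-stable (finite? B (proj₁ B-supp) a) (finiteSupport∌⇒ B B-supp))

    -- Sequences of atoms: statements (1) and (2)

    module _ (a b : 𝔸.Carrier) where

      select : Fin 2 → 𝔸.Carrier
      select zero    = a
      select (suc _) = b

      select-fixed : ∀ {π} → to π a 𝔸.≈ a → to π b 𝔸.≈ b → ∀ i → to π (select i) 𝔸.≈ select i
      select-fixed πa≈a _    zero    = πa≈a
      select-fixed _    πb≈b (suc _) = πb≈b

      select-vanishes : ∀ {i} → i ≡ zero → select i 𝔸.≈ a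
      select-vanishes ≡.refl = 𝔸.refl

      sequence : (ℕ → Fin 2) → Carrier (quotient ⊥ ^ discreteℕ)
      sequence α = record { to = select ∘ α ∘ lower ; cong = λ { ≡.refl → inj₁ 𝔸.refl } }
        -- Permutations act trivially on ℕ, so conjugation is postcomposition, and every value is
        -- `a` or `b`.
        , fromList (a ∷ b ∷ []) , fromList-finite (a ∷ b ∷ [])
        , λ π π-fixes n → inj₁ (select-fixed {π} (π-fixes a (here 𝔸.refl))
            (π-fixes b (there (here 𝔸.refl))) (α (lower n)))

      -- If `α n` were 1, the value at `n` would be `b`. Swapping `b` with a fresh `d` fixes `A`
      -- pointwise, hence the sequence, yet turns this value into `d`.
      support∌⇒vanishes : ∀ α (A : Subset Atoms ℓ) →
        IsFiniteSupport (permSet (quotient ⊥ ^ discreteℕ)) A (sequence α) → b ∉ A → Vanishes α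
      support∌⇒vanishes α A (A-fin , A-supp) b∉A n with α n in αn≡
      ... | zero     = ≡.refl
      ... | suc zero =
        let (d , d∉A , d≉b) = fresh A A-fin b
        in contradiction
             (swap-fixes (permSet (quotient ⊥ ^ discreteℕ)) A {sequence α} A-supp b∉A d∉A (lift n))
             λ where
               (inj₁ bd·f≈f) → d≉b (𝔸.trans (𝔸.sym (swap-fst b d 𝔸.refl))
                 (≡.subst (λ i → swap b d (select i) 𝔸.≈ select i) αn≡ bd·f≈f))

    supportFunction-𝔸^ℕ⇒WLPO : AdmitsSupportFunction (quotient ⊥ ^ discreteℕ) → WLPO
    supportFunction-𝔸^ℕ⇒WLPO (S , S-supp) α =
      let a               = atom
          const-a         = sequence a a (const zero)
          (U , U-fin)     = Func.to S const-a
          (b , b∉U , _)   = fresh U U-fin a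
          f               = sequence a b α
          (V , V-fin)     = Func.to S f
      in case finite? V V-fin b of λ where
           (no  b∉V) → inj₁ (support∌⇒vanishes a b α V (V-fin , S-supp f) b∉V)
           -- If `α` vanishes, `f` equals `const-a`. As `S` respects equality, `V ⊆ U`, which puts
           -- `b` in `U`.
           (yes b∈V) → inj₂ λ v → b∉U (proj₁ (Func.cong S {f} {const-a}
             λ n → inj₁ (select-vanishes a b (v (lower n)))) b b∈V)

    -- Supports in 𝔸/P: statements (3) to (8)

    finite⋂⇒WLPO : (∀ P a → Finite (subsetoid (⋂FiniteSupports (quotientPermSet P) a))) → WLPO
    finite⋂⇒WLPO ⋂-finite α with finite? (⋂FiniteSupports X atom) (⋂-finite (¬ Vanishes α) atom) atom
      where X = quotientPermSet (¬ Vanishes α)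
    ... | yes a∈⋂ = inj₁ (vanishes-stable α (∈⋂⇒¬ a∈⋂))
    -- If `α` vanishes, then `P` (here `¬ Vanishes α`) fails, so no finite support misses `atom`,
    -- contradicting `a∉⋂`.
    ... | no  a∉⋂ = inj₂ λ v → a∉⋂ λ A A-supp →
            decidable-stable (finite? A (proj₁ A-supp) atom) λ a∉A → finiteSupport∌⇒ A A-supp a∉A v

    -- The goal makes `P` the disjunction Q ∨ ¬ Q for Q = `Vanishes α`. Membership of `atom` in the
    -- intersection would refute this disjunction, which is impossible, so the intersection misses
    -- `atom`.
    support⋂⇒WLPO :
      (∀ P a → IsSupport (quotientPermSet P) (⋂FiniteSupports (quotientPermSet P) a) a) → WLPO
    support⋂⇒WLPO ⋂-supp α = support⊆｛｝∌⇒ (⋂FiniteSupports (quotientPermSet _) atom)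
      (⋂-supp _ atom)
      (λ _ x∈⋂ → x∈⋂ ｛ atom ｝ ｛｝-isFiniteSupport)
      (λ a∈⋂ → ¬¬[⊎¬] (∈⋂⇒¬ a∈⋂))

    module _ (α : ℕ → Fin 2) where
      private
        Q = Vanishes α
        X = quotientPermSet (Q ⊎ ¬ Q)

      -- Missing `atom` means ¬ Q here, and ¬ ¬ Q, hence Q, for the companion set `｛ atom ∣ ¬ Q ｝`;
      -- either way the disjunction is settled.
      ｛∣vanishes｝-support : IsSubfiniteSupport X ｛ atom ∣ Q ｝ atom
      ｛∣vanishes｝-support = ｛∣｝-subfinite atom Q ,
        isSupport ｛ atom ∣ Q ｝ λ a∉ → inj₂ λ v → a∉ (𝔸.refl , v)

      ｛∣¬vanishes｝-support : IsSubfiniteSupport X ｛ atom ∣ ¬ Q ｝ atom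
      ｛∣¬vanishes｝-support = ｛∣｝-subfinite atom (¬ Q) ,
        isSupport ｛ atom ∣ ¬ Q ｝ λ a∉ → inj₁ (vanishes-stable α λ ¬v → a∉ (𝔸.refl , ¬v))

    -- The two subfinite supports carry the contradictory conditions Q and ¬ Q, so their
    -- intersection is empty and yet must support `atom`.
    support∩⇒WLPO : (∀ P a (S T : Subset Atoms ℓ) → let X = quotientPermSet P in
      IsSubfiniteSupport X S a → IsSubfiniteSupport X T a → IsSupport X (S ∩ T) a) → WLPO
    support∩⇒WLPO ∩-supp α = support⊆｛｝∌⇒ (｛ atom ∣ _ ｝ ∩ ｛ atom ∣ _ ｝)
      (∩-supp _ atom ｛ atom ∣ _ ｝ ｛ atom ∣ _ ｝ (｛∣vanishes｝-support α) (｛∣¬vanishes｝-support α))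
      (λ _ ((x≈a , _) , _) → x≈a)
      (λ ((_ , v) , (_ , ¬v)) → ¬v v)

    -- A finite support inside `｛ atom ∣ Q ｝` decides whether it contains `atom`: if so Q holds, and
    -- if not the support yields Q ∨ ¬ Q itself.
    finiteSubsupport⇒WLPO : (∀ P a (S : Subset Atoms ℓ) → let X = quotientPermSet P in
      IsSubfiniteSupport X S a → Σ[ S′ ∈ Subset Atoms ℓ ] IsFiniteSupport X S′ a × S′ ⊆ S) → WLPO
    finiteSubsupport⇒WLPO shrink α with shrink _ atom ｛ atom ∣ _ ｝ (｛∣vanishes｝-support α)
    ... | S′ , S′-supp , S′⊆S with finite? S′ (proj₁ S′-supp) atom
    ...   | yes a∈S′ = inj₁ (proj₂ (S′⊆S atom a∈S′))
    ...   | no  a∉S′ = finiteSupport∌⇒ S′ S′-supp a∉S′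

theorem3 : ∀ {ℓ : Level} (𝔸 : DecSetoid ℓ ℓ) → Infinite (DecSetoid.setoid 𝔸) →
  let open Nominal 𝔸
      open NominalSet using (Carrier)
      open NominalSet using (permSet)
  in
  ( (∀ (X Y : NominalSet ℓ ℓ) →
       AdmitsSupportFunction X → AdmitsSupportFunction Y → AdmitsSupportFunction (Y ^ X))
  ⊎ (∀ (X Y : NominalSet ℓ ℓ) →
       (∀ (x : Carrier X) → HasLeastFiniteSupport (permSet X) x) →
       (∀ (y : Carrier Y) → HasLeastFiniteSupport (permSet Y) y) →
       (∀ (f : Carrier (Y ^ X)) → HasLeastFiniteSupport (permSet (Y ^ X)) f))
  ⊎ (∀ (X : NominalSet ℓ ℓ) (x : Carrier X) →
       Finite (subsetoid (⋂FiniteSupports (permSet X) x)))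
  ⊎ (∀ (X : NominalSet ℓ ℓ) (x : Carrier X) →
       IsSupport (permSet X) (⋂FiniteSupports (permSet X) x) x)
  ⊎ (∀ (X : NominalSet ℓ ℓ) (x : Carrier X) → HasLeastFiniteSupport (permSet X) x)
  ⊎ (∀ (X : NominalSet ℓ ℓ) (x : Carrier X) → HasLeastSubfiniteSupport (permSet X) x)
  ⊎ (∀ (X : NominalSet ℓ ℓ) (x : Carrier X) (S T : Subset Atoms ℓ) →
       IsSubfiniteSupport (permSet X) S x → IsSubfiniteSupport (permSet X) T x →
       IsSupport (permSet X) (S ∩ T) x)
  ⊎ (∀ (X : NominalSet ℓ ℓ) (x : Carrier X) (S : Subset Atoms ℓ) →
       IsSubfiniteSupport (permSet X) S x →
       Σ[ S′ ∈ Subset Atoms ℓ ] IsFiniteSupport (permSet X) S′ x × S′ ⊆ S)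
  ) → WLPO
theorem3 𝔸 infinite = λ where
    (inj₁ s₁) → supportFunction-𝔸^ℕ⇒WLPO 𝔸 infinite
      (s₁ (discreteℕ 𝔸) (quotient 𝔸 ⊥)
        (leastFiniteSupports⇒supportFunction 𝔸 (discreteℕ 𝔸) (discreteℕ-leastFiniteSupport 𝔸))
        (leastFiniteSupports⇒supportFunction 𝔸 (quotient 𝔸 ⊥)
          (quotient-⊥-leastFiniteSupport 𝔸 infinite)))
    (inj₂ (inj₁ s₂)) → supportFunction-𝔸^ℕ⇒WLPO 𝔸 infinite
      (leastFiniteSupports⇒supportFunction 𝔸 (quotient 𝔸 ⊥ ^ discreteℕ 𝔸)
        (s₂ (discreteℕ 𝔸) (quotient 𝔸 ⊥)
          (discreteℕ-leastFiniteSupport 𝔸) (quotient-⊥-leastFiniteSupport 𝔸 infinite)))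
    (inj₂ (inj₂ (inj₁ s₃))) → finite⋂⇒WLPO 𝔸 infinite (s₃ ∘ quotient 𝔸)
    (inj₂ (inj₂ (inj₂ (inj₁ s₄)))) → support⋂⇒WLPO 𝔸 infinite (s₄ ∘ quotient 𝔸)
    (inj₂ (inj₂ (inj₂ (inj₂ (inj₁ s₅))))) → support⋂⇒WLPO 𝔸 infinite λ P a →
      leastFiniteSupport⇒support⋂ 𝔸 (quotientPermSet 𝔸 P) (s₅ (quotient 𝔸 P) a)
    (inj₂ (inj₂ (inj₂ (inj₂ (inj₂ (inj₁ s₆)))))) → support∩⇒WLPO 𝔸 infinite λ P a →
      leastSubfiniteSupport⇒support∩ 𝔸 (quotientPermSet 𝔸 P) (s₆ (quotient 𝔸 P) a)
    (inj₂ (inj₂ (inj₂ (inj₂ (inj₂ (inj₂ (inj₁ s₇))))))) →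
      support∩⇒WLPO 𝔸 infinite (s₇ ∘ quotient 𝔸)
    (inj₂ (inj₂ (inj₂ (inj₂ (inj₂ (inj₂ (inj₂ s₈))))))) →
      finiteSubsupport⇒WLPO 𝔸 infinite (s₈ ∘ quotient 𝔸)
  where open Nominal 𝔸 using (_^_)
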